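{- Let $\preccurlyeq$ be any of the three stochastic simulation pre-orders $\preccurlyeq_i^S$, $\preccurlyeq_\pi^S$, $\preccurlyeq_m^S$. There is no $\preccurlyeq$-universal stochastic cellular automaton, i.e. there is no stochastic cellular automaton $\mathcal{A}$ such that $\mathcal{B}\preccurlyeq\mathcal{A}$ for every stochastic cellular automaton $\mathcal{B}$.
   Context: A (one-dimensional) stochastic cellular automaton (CA) is a tuple $\mathcal{A}=(Q,R,V,V',f)$ where $Q$ (states) and $R$ (random symbols) are finite sets, $V=\{v_1,\dots,v_\rho\}$ and $V'=\{v'_1,\dots,v'_{\rho'}\}$ are finite subsets of $\mathbb{Z}$, and $f:Q^\rho\times R^{\rho'}\to Q$. Its explicit global function is $F:Q^{\mathbb{Z}}\times R^{\mathbb{Z}}\to Q^{\mathbb{Z}}$, $F(c,s)_z=f\big((c_{z+v_j})_j,(s_{z+v'_j})_j\big)$, with iterates $F^0(c)=c$, $F^{t+1}(c,s^1,\dots,s^{t+1})=F(F^t(c,s^1,\dots,s^t),s^{t+1})$. The stochastic global function maps $c\in Q^{\mathbb{Z}}$ to $\mathcal{S}_F(c)$, the law of $F(c,s)$ for $s$ drawn from the uniform (i.i.d. uniform product) measure on $R^{\mathbb{Z}}$. Restriction: if $i:Q'\to Q$ is injective with cell-by-cell extension $I:Q'^{\mathbb{Z}}\to Q^{\mathbb{Z}}$ and $Y=(i(Q'))^{\mathbb{Z}}$ satisfies $F(Y,R^{\mathbb{Z}})\subseteq Y$, the $i$-restriction of $\mathcal{A}$ is the stochastic CA with states $Q'$,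 random symbols $R$, the same neighborhoods, and explicit global function ${}_iF(c,s)=I^{ -1}(F(I(c),s))$ for $c\in Q'^{\mathbb{Z}}$. Projection: if $\pi:Q\to Q'$ is surjective with cell-by-cell extension $\Pi$, and $\Pi(F(c,s))=\Pi(F(c',s))$ for all $s$ and all $c,c'$ with $\Pi(c)=\Pi(c')$, the $\pi$-projection of $\mathcal{A}$ is the stochastic CA with states $Q'$, random symbols $R$, the same neighborhoods, and explicit global function ${}^\pi F(c',s)=\Pi(F(c,s))$ for any $c\in\Pi^{ -1}(c')$. Local relations: $\mathcal{A}_1$ is related to $\mathcal{A}_2$ by the injection relation (resp. projection relation, resp. mixed relation) if some $i$-restriction of $\mathcal{A}_2$ (resp. some $\pi$-projection of $\mathcal{A}_2$, resp. some $\pi$-projection of some $i$-restriction of $\mathcal{A}_2$), with explicit global function $G$, satisfies $\mathcal{S}_{F_1}=\mathcal{S}_G$ (in particular it has the same state set as $\mathcal{A}_1$). Rescaling: for $m,t\ge1$, $z\in\mathbb{Z}$, let $b_m:S^{\mathbb{Z}}\to(S^m)^{\mathbb{Z}}$, $b_m(c)_x=(c_{mx},\dots,c_{mx+m-1})$, and $\sigma_z(c)_x=c_{x+z}$. The rescaling $\mathcal{A}^{\langle m,t,z\rangle}$ is the stochastic CA with states $Q^m$, random symbols $(R^m)^t$, suitably modified neighborhoods, and explicit global function $(c,s)\mapsto b_m\circ\sigma_z\circ F^t(b_m^{ -1}(c),b_m^{ -1}(s^1),\dots,b_m^{ -1}(s^t))$, where $s^1,\dots,s^t\in(R^m)^{\mathbb{Z}}$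 are the $t$ components of $s$. Simulation: $\mathcal{A}_1\preccurlyeq\mathcal{A}_2$ iff there exist $m_1,m_2,t_1,t_2\ge1$ and $z_1,z_2\in\mathbb{Z}$ such that $\mathcal{A}_1^{\langle m_1,t_1,z_1\rangle}$ is in the corresponding local relation to $\mathcal{A}_2^{\langle m_2,t_2,z_2\rangle}$; $\preccurlyeq_i^S,\preccurlyeq_\pi^S,\preccurlyeq_m^S$ correspond to the injection, projection and mixed local relations respectively. -}

module Defs where

import Algebra.Bundles as Algebra
import Algebra.Properties.Group as Group
open import Data.Bool using (if_then_else_)
open import Data.Empty using (⊥-elim)
open import Data.Fin as Fin using (Fin; zero; suc; toℕ; fromℕ; fromℕ<; inject₁)
import Data.Fin.Properties as Fin
open import Data.Integer as ℤ using (ℤ; +_; -[1+_]; _+_; _-_; _*_; -_; ∣_∣; 0ℤ)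
open import Data.Integer.DivMod using (_/ℕ_; _%ℕ_; n%ℕd<d)
import Data.Integer.DivMod as DivMod
import Data.Integer.Properties as ℤ
open import Data.Integer.Tactic.RingSolver using (solve-∀)
open import Data.List as List using (List)
open import Data.Nat as ℕ using (ℕ; zero; suc; NonZero; s≤s)
import Data.Nat.DivMod as ℕ
import Data.Nat.Properties as ℕ
open import Data.Product using (Σ; ∃; _×_; _,_; proj₂)
open import Data.Product.Function.NonDependent.Propositional using (_×-↔_)
open import Data.Rational using (ℚ; _/_)
open import Data.Vec as Vec using (Vec; []; _∷_; map; lookup; tabulate)
import Data.Vec.Properties as Vec
open import Data.Vec.Relation.Unary.Unique.Propositional using (Unique)
open import Data.Vec.Relation.Unary.Unique.Propositional.Properties using (tabulate⁺)
open import Function using (_∘_; _↔_; Inverse; mk↔ₛ′)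
open import Function.Construct.Composition using (_↔-∘_)
open import Function.Definitions using (Injective; Surjective)
open import Function.Properties.Inverse using (↔⇒↣)
open import Level as Level using (0ℓ; Lift)
open import Relation.Binary.Definitions using (DecidableEquality)
open import Relation.Binary.PropositionalEquality
open import Relation.Nullary using (Dec; does; yes; no)
open import Relation.Unary using (Pred; Decidable)

private
  +-cancelˡ : ∀ i j k → i + j ≡ i + k → j ≡ k
  +-cancelˡ = Group.∙-cancelˡ (Algebra.AbelianGroup.group ℤ.+-0-abelianGroup)

  +-cancelʳ : ∀ i j k → j + i ≡ k + i → j ≡ k
  +-cancelʳ = Group.∙-cancelʳ (Algebra.AbelianGroup.group ℤ.+-0-abelianGroup)

------------------------------------------------------------------------
-- Finite sets

-- Alphabets are taken nonempty: with no random symbol there is no uniform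
-- measure, and with no state there is no configuration.

record FinSet : Set₁ where
  field
    ⟦_⟧         : Set
    card        : ℕ
    {{nonZero}} : NonZero card
    enum        : ⟦_⟧ ↔ Fin card

open FinSet public using (⟦_⟧; card)

module _ (X : FinSet) where
  open FinSet X using (nonZero; enum)

  element : Fin (card X) → ⟦ X ⟧
  element = Inverse.from enum

  elements : List ⟦ X ⟧
  elements = List.map element (List.allFin (card X))

  default : ⟦ X ⟧
  default = element (fromℕ< (ℕ.>-nonZero⁻¹ (card X)))

  ≟-dec : DecidableEquality ⟦ X ⟧
  ≟-dec = Fin.inj⇒≟ (↔⇒↣ enum)

private
  Vec-enum : ∀ {A : Set} {k} → A ↔ Fin k → ∀ n → Vec A n ↔ Fin (k ℕ.^ n)
  Vec-enum e zero    = mk↔ₛ′ (λ _ → zero) (λ _ → []) (λ { zero → refl }) (λ { [] → refl })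
  Vec-enum {A} {k} e (suc n) =
    cons ⟫ ((e ×-↔ Vec-enum e n) ⟫ mk↔ₛ′ (λ (i , j) → Fin.combine i j) (Fin.remQuot (k ℕ.^ n))
      (Fin.combine-remQuot {k} (k ℕ.^ n)) (λ (i , j) → Fin.remQuot-combine i j))
    where
    infixr 5 _⟫_
    _⟫_ : ∀ {A B C : Set} → A ↔ B → B ↔ C → A ↔ C
    f ⟫ g = g ↔-∘ f

    cons : Vec A (suc n) ↔ (A × Vec A n)
    cons = mk↔ₛ′ (λ { (x ∷ xs) → x , xs }) (λ (x , xs) → x ∷ xs) (λ _ → refl)
                 (λ { (x ∷ xs) → refl })

infixr 8 _^ᶠ_

_^ᶠ_ : FinSet → ℕ → FinSet
X ^ᶠ n = record
  { ⟦_⟧     = Vec ⟦ X ⟧ n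
  ; card    = card X ℕ.^ n
  ; nonZero = ℕ.m^n≢0 (card X) n
  ; enum    = Vec-enum (FinSet.enum X) n
  }
  where open FinSet X using (nonZero)

-- The uniform probability of a decidable event.
uniform : (X : FinSet) {P : Pred ⟦ X ⟧ 0ℓ} → Decidable P → ℚ
uniform X P? = + List.length (List.filter P? (elements X)) / card X
  where open FinSet X using (nonZero)

------------------------------------------------------------------------
-- Configurations

Config : FinSet → Set
Config X = ℤ → ⟦ X ⟧

shift : ∀ {X} → ℤ → Config X → Config X
shift z c x = c (x + z)

-- (c_a , … , c_{a+n-1})
window : ∀ {A : Set} → ℤ → (n : ℕ) → (ℤ → A) → Vec A n
window a n c = tabulate λ k → c (a + + toℕ k)

-- A configuration having the word w at a; its value elsewhere is arbitrary and
-- plays no role in the uses below.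
fill : ∀ X {n} → ℤ → Vec ⟦ X ⟧ n → Config X
fill X a []      z = default X
fill X a (x ∷ w) z = if does (z ℤ.≟ a) then x else fill X (ℤ.suc a) w z

fill-lookup : ∀ X {n} a (w : Vec ⟦ X ⟧ n) k → fill X a w (a + + toℕ k) ≡ lookup w k
fill-lookup X a (x ∷ w) zero with (a + + 0) ℤ.≟ a
... | yes _ = refl
... | no ¬p = ⊥-elim (¬p (ℤ.+-identityʳ a))
fill-lookup X a (x ∷ w) (suc k) with (a + + suc (toℕ k)) ℤ.≟ a
... | yes p with () ← +-cancelˡ a _ _ (trans p (sym (ℤ.+-identityʳ a)))
... | no _  = trans (cong (fill X (ℤ.suc a) w) (reindex a (+ toℕ k))) (fill-lookup X (ℤ.suc a) w k)
  where
  reindex : ∀ a k → a + (+ 1 + k) ≡ (+ 1 + a) + k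
  reindex = solve-∀

-- The bijection b_m between X^ℤ and (X^m)^ℤ, and its inverse.
block : ∀ X m → Config X → Config (X ^ᶠ m)
block X m c x = window (+ m * x) m c

unblock : ∀ X m .{{_ : NonZero m}} → Config (X ^ᶠ m) → Config X
unblock X m d y = lookup (d (y /ℕ m)) (fromℕ< (n%ℕd<d y m))

private
  /ℕ-bound : ∀ i m .{{_ : NonZero m}} → ∣ i /ℕ m ∣ ℕ.≤ ∣ i ∣ ℕ.+ m
  /ℕ-bound i m = begin
    ∣ q ∣                  ≤⟨ ℕ.m≤m*n ∣ q ∣ m ⟩
    ∣ q ∣ ℕ.* m            ≡⟨ ℤ.abs-* q (+ m) ⟨
    ∣ q * + m ∣            ≡⟨ cong ∣_∣ (solve (+ r) (q * + m)) ⟩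
    ∣ + r + q * + m - + r ∣ ≡⟨ cong (λ i → ∣ i - + r ∣) (DivMod.a≡a%ℕn+[a/ℕn]*n i m) ⟨
    ∣ i - + r ∣            ≤⟨ ℤ.∣i-j∣≤∣i∣+∣j∣ i (+ r) ⟩
    ∣ i ∣ ℕ.+ r            ≤⟨ ℕ.+-monoʳ-≤ ∣ i ∣ (ℕ.<⇒≤ (n%ℕd<d i m)) ⟩
    ∣ i ∣ ℕ.+ m            ∎
    where
    open ℕ.≤-Reasoning
    q = i /ℕ m
    r = i %ℕ m
    solve : ∀ r p → p ≡ r + p - r
    solve = solve-∀

  quotient-unique : ∀ m .{{_ : NonZero m}} {r r′} q q′ → r ℕ.< m → r′ ℕ.< m →
                    + r + q * + m ≡ + r′ + q′ * + m → q ≡ q′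
  quotient-unique m {r} {r′} q q′ r<m r′<m eq = ℤ.i-j≡0⇒i≡j q q′ (ℤ.∣i∣≡0⇒i≡0 (ℕ.n<1⇒n≡0
    (ℕ.*-cancelʳ-< m _ 1 (begin-strict
      ∣ q - q′ ∣ ℕ.* m     ≡⟨ ℤ.abs-* (q - q′) (+ m) ⟨
      ∣ (q - q′) * + m ∣   ≡⟨ cong ∣_∣ difference ⟩
      ∣ + r′ - + r ∣       ≡⟨ cong ∣_∣ (ℤ.m-n≡m⊖n r′ r) ⟩
      ∣ r′ ℤ.⊖ r ∣         ≤⟨ ℤ.∣m⊝n∣≤m⊔n r′ r ⟩
      r′ ℕ.⊔ r             <⟨ ℕ.⊔-pres-<m r′<m r<m ⟩
      m                    ≡⟨ ℕ.*-identityˡ m ⟨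
      1 ℕ.* m              ∎))))
    where
    open ℕ.≤-Reasoning
    expand : ∀ r q q′ m → (q - q′) * m ≡ r + q * m - q′ * m - r
    expand = solve-∀
    collapse : ∀ r r′ q′ m → r′ + q′ * m - q′ * m - r ≡ r′ - r
    collapse = solve-∀
    difference : (q - q′) * + m ≡ + r′ - + r
    difference = trans (expand (+ r) q q′ (+ m))
      (trans (cong (λ i → i - q′ * + m - + r) eq) (collapse (+ r) (+ r′) q′ (+ m)))

  module _ (m : ℕ) .{{_ : NonZero m}} (x y : ℤ) where
    private
      eq : + ((+ m * x + y) %ℕ m) + ((+ m * x + y) /ℕ m) * + m ≡ + (y %ℕ m) + (x + y /ℕ m) * + m
      eq = trans (sym (DivMod.a≡a%ℕn+[a/ℕn]*n (+ m * x + y) m))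
        (trans (cong (λ i → + m * x + i) (DivMod.a≡a%ℕn+[a/ℕn]*n y m)) (rearrange (+ m) x (+ (y %ℕ m)) (y /ℕ m)))
        where
        rearrange : ∀ m x r q → m * x + (r + q * m) ≡ r + (x + q) * m
        rearrange = solve-∀

    /ℕ-shift : (+ m * x + y) /ℕ m ≡ x + y /ℕ m
    /ℕ-shift = quotient-unique m _ _ (n%ℕd<d (+ m * x + y) m) (n%ℕd<d y m) eq

    %ℕ-shift : (+ m * x + y) %ℕ m ≡ y %ℕ m
    %ℕ-shift = ℤ.+-injective (+-cancelʳ (((+ m * x + y) /ℕ m) * + m) _ _
      (trans eq (cong (λ q → + (y %ℕ m) + q * + m) (sym /ℕ-shift))))

unblock-local : ∀ X m .{{_ : NonZero m}} (d d′ : Config (X ^ᶠ m)) K x →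
                (∀ y → ∣ y ∣ ℕ.≤ K ℕ.+ m → d (x + y) ≡ d′ y) →
                ∀ y → ∣ y ∣ ℕ.≤ K → unblock X m d (+ m * x + y) ≡ unblock X m d′ y
unblock-local X m d d′ K x d≈ y y≤K = cong₂ lookup
  (trans (cong d (/ℕ-shift m x y))
         (d≈ (y /ℕ m) (ℕ.≤-trans (/ℕ-bound y m) (ℕ.+-monoˡ-≤ m y≤K))))
  (Fin.fromℕ<-cong _ _ (%ℕ-shift m x y) _ _)

unblock-block : ∀ X m .{{_ : NonZero m}} c y → unblock X m (block X m c) y ≡ c y
unblock-block X m c y = trans (Vec.lookup∘tabulate _ (fromℕ< (n%ℕd<d y m))) (cong c (begin
  + m * (y /ℕ m) + + toℕ (fromℕ< (n%ℕd<d y m))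
    ≡⟨ cong (λ r → + m * (y /ℕ m) + + r) (Fin.toℕ-fromℕ< (n%ℕd<d y m)) ⟩
  + m * (y /ℕ m) + + (y %ℕ m)   ≡⟨ rearrange (+ m) (y /ℕ m) (+ (y %ℕ m)) ⟩
  + (y %ℕ m) + (y /ℕ m) * + m   ≡⟨ DivMod.a≡a%ℕn+[a/ℕn]*n y m ⟨
  y                             ∎))
  where
  open ≡-Reasoning
  rearrange : ∀ m q r → m * q + r ≡ r + q * m
  rearrange = solve-∀

block-unblock : ∀ X m .{{_ : NonZero m}} d x → block X m (unblock X m d) x ≡ d x
block-unblock X m d x = trans (Vec.tabulate-cong entry) (Vec.tabulate∘lookup (d x))
  where
  entry : ∀ k → unblock X m d (+ m * x + + toℕ k) ≡ lookup (d x) k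
  entry k = cong₂ lookup
    (cong d (trans (/ℕ-shift m x (+ toℕ k))
      (trans (cong (λ q → x + + q) (ℕ.m<n⇒m/n≡0 (Fin.toℕ<n k))) (ℤ.+-identityʳ x))))
    (trans (Fin.fromℕ<-cong _ _ (trans (%ℕ-shift m x (+ toℕ k)) (ℕ.m<n⇒m%n≡m (Fin.toℕ<n k))) _ _)
           (Fin.fromℕ<-toℕ k (Fin.toℕ<n k)))

-- A Borel probability measure on X^ℤ, presented by its values on the cylinders
-- { c | window z n c ≡ u }, which determine it.
Measure : FinSet → Set
Measure X = ℤ → ∀ {n} → Vec ⟦ X ⟧ n → ℚ

infix 4 _≈ᵐ_

_≈ᵐ_ : ∀ {X} → Measure X → Measure X → Set
_≈ᵐ_ {X} μ ν = ∀ z n (u : Vec ⟦ X ⟧ n) → μ z u ≡ ν z u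

------------------------------------------------------------------------
-- Stochastic cellular automata

record SCA : Set₁ where
  field
    states random : FinSet
    {ρ ρ′}        : ℕ
    V             : Vec ℤ ρ
    V-unique      : Unique V
    V′            : Vec ℤ ρ′
    V′-unique     : Unique V′
    f             : Vec ⟦ states ⟧ ρ → Vec ⟦ random ⟧ ρ′ → ⟦ states ⟧

open SCA public

radius : ∀ {n} → Vec ℤ n → ℕ
radius V = Vec.foldr′ (λ v r → ∣ v ∣ ℕ.⊔ r) 0 V

private
  offset : ∀ {N} v → ∣ v ∣ ℕ.≤ N → ∃ λ j → j ℕ.≤ N ℕ.+ N × v ≡ - + N + + j
  offset {N} (+ n) n≤N = N ℕ.+ n , ℕ.+-monoʳ-≤ N n≤N , reindex (+ N) (+ n)
    where
    reindex : ∀ N n → n ≡ - N + (N + n)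
    reindex = solve-∀
  offset {N} -[1+ n ] n<N = N ℕ.∸ suc n , ℕ.≤-trans (ℕ.m∸n≤m N (suc n)) (ℕ.m≤m+n N N) ,
    trans (reindex (+ N) (+ suc n)) (cong (λ i → - + N + i) (trans (ℤ.m-n≡m⊖n N (suc n)) (ℤ.⊖-≥ n<N)))
    where
    reindex : ∀ N n → - n ≡ - N + (N - n)
    reindex = solve-∀

  map-local : ∀ {A : Set} {n} (V : Vec ℤ n) {c c′ : ℤ → A} →
              (∀ v → ∣ v ∣ ℕ.≤ radius V → c v ≡ c′ v) → map c V ≡ map c′ V
  map-local []      eq = refl
  map-local (v ∷ V) eq = cong₂ _∷_ (eq v (ℕ.m≤m⊔n _ _))
                           (map-local V λ u u≤ → eq u (ℕ.≤-trans u≤ (ℕ.m≤n⊔m ∣ v ∣ _)))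

module _ (A : SCA) where

  global : Config (states A) → Config (random A) → Config (states A)
  global c s z = f A (map (λ v → c (z + v)) (V A)) (map (λ v → s (z + v)) (V′ A))

  iterate : ∀ t → Config (states A) → (Fin t → Config (random A)) → Config (states A)
  iterate zero    c s = c
  iterate (suc t) c s = global (iterate t c (s ∘ inject₁)) (s (fromℕ t))

  -- The law of global c s for uniform s.  The cells z , … , z+n-1 of global c s
  -- depend only on the cells of s within distance radius V′ of them, so the
  -- probability of a cylinder is computed by choosing uniformly the word that s
  -- has on that finite window (see global-window below).
  stochastic : Config (states A) → Measure (states A)
  stochastic c z {n} u =
    uniform (random A ^ᶠ (n ℕ.+ 2 ℕ.* N))
      (λ w → Vec.≡-dec (≟-dec (states A)) (window z n (global c (fill (random A) (z - + N) w))) u)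
    where N = radius (V′ A)

  global-local : ∀ c c′ s s′ z z′ →
                 (∀ v → ∣ v ∣ ℕ.≤ radius (V A) → c (z + v) ≡ c′ (z′ + v)) →
                 (∀ v → ∣ v ∣ ℕ.≤ radius (V′ A) → s (z + v) ≡ s′ (z′ + v)) →
                 global c s z ≡ global c′ s′ z′
  global-local c c′ s s′ z z′ c≈ s≈ = cong₂ (f A) (map-local (V A) c≈) (map-local (V′ A) s≈)

  global-window : ∀ c s z n → let N = radius (V′ A); a = z - + N in
    window z n (global c s) ≡
    window z n (global c (fill (random A) a (window a (n ℕ.+ 2 ℕ.* N) s)))
  global-window c s z n = Vec.tabulate-cong λ k →
    global-local c c s (fill (random A) a (window a L s)) (z + + toℕ k) (z + + toℕ k) (λ _ _ → refl) (inside k)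
    where
    N = radius (V′ A)
    a = z - + N
    L = n ℕ.+ 2 ℕ.* N

    reindex : ∀ z N k j → z + k + (- N + j) ≡ z - N + (k + j)
    reindex = solve-∀

    inside : ∀ (k : Fin n) v → ∣ v ∣ ℕ.≤ N →
             s (z + + toℕ k + v) ≡ fill (random A) a (window a L s) (z + + toℕ k + v)
    inside k v v≤N with offset v v≤N
    ... | j , j≤2N , refl = sym (begin
      fill (random A) a (window a L s) (z + + toℕ k + (- + N + + j))
        ≡⟨ cong (fill (random A) a (window a L s)) p ⟩
      fill (random A) a (window a L s) (a + + toℕ l)
        ≡⟨ fill-lookup (random A) a (window a L s) l ⟩
      lookup (window a L s) l
        ≡⟨ Vec.lookup∘tabulate _ l ⟩
      s (a + + toℕ l)
        ≡⟨ cong s p ⟨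
      s (z + + toℕ k + (- + N + + j)) ∎)
      where
      open ≡-Reasoning
      l<L : toℕ k ℕ.+ j ℕ.< L
      l<L = ℕ.+-mono-<-≤ (Fin.toℕ<n k)
              (subst (j ℕ.≤_) (cong (N ℕ.+_) (sym (ℕ.+-identityʳ N))) j≤2N)
      l = fromℕ< l<L
      p : z + + toℕ k + (- + N + + j) ≡ a + + toℕ l
      p = trans (reindex z (+ N) (+ toℕ k) (+ j))
                (cong (λ l → a + + l) (sym (Fin.toℕ-fromℕ< l<L)))

  iterate-local : ∀ t B c c′ s s′ a → let N = radius (V A) ℕ.⊔ radius (V′ A) in
                  (∀ v → ∣ v ∣ ℕ.≤ B ℕ.+ t ℕ.* N → c (a + v) ≡ c′ v) →
                  (∀ j v → ∣ v ∣ ℕ.≤ B ℕ.+ t ℕ.* N → s j (a + v) ≡ s′ j v) →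
                  ∀ v → ∣ v ∣ ℕ.≤ B → iterate t c s (a + v) ≡ iterate t c′ s′ v
  iterate-local zero    B c c′ s s′ a c≈ s≈ v v≤B = c≈ v (ℕ.≤-trans v≤B (ℕ.m≤m+n B 0))
  iterate-local (suc t) B c c′ s s′ a c≈ s≈ v v≤B = global-local
    (iterate t c (s ∘ inject₁)) (iterate t c′ (s′ ∘ inject₁)) (s (fromℕ t)) (s′ (fromℕ t)) (a + v) v
    (λ u u≤ → trans (cong (iterate t c (s ∘ inject₁)) (ℤ.+-assoc a v u))
      (iterate-local t (B ℕ.+ N) c c′ (s ∘ inject₁) (s′ ∘ inject₁) a
        (λ w w≤ → c≈ w (reassoc w≤))
        (λ j w w≤ → s≈ (inject₁ j) w (reassoc w≤))
        (v + u) (near u (ℕ.≤-trans u≤ (ℕ.m≤m⊔n (radius (V A)) _)))))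
    (λ u u≤ → trans (cong (s (fromℕ t)) (ℤ.+-assoc a v u))
      (s≈ (fromℕ t) (v + u)
        (reassoc (ℕ.≤-trans (near u (ℕ.≤-trans u≤ (ℕ.m≤n⊔m (radius (V A)) _))) (ℕ.m≤m+n _ _)))))
    where
    N = radius (V A) ℕ.⊔ radius (V′ A)
    reassoc : ∀ {k} → k ℕ.≤ B ℕ.+ N ℕ.+ t ℕ.* N → k ℕ.≤ B ℕ.+ suc t ℕ.* N
    reassoc {k} = subst (k ℕ.≤_) (ℕ.+-assoc B N (t ℕ.* N))
    near : ∀ u → ∣ u ∣ ℕ.≤ N → ∣ v + u ∣ ℕ.≤ B ℕ.+ N
    near u u≤ = ℕ.≤-trans (ℤ.∣i+j∣≤∣i∣+∣j∣ v u) (ℕ.+-mono-≤ v≤B u≤)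

------------------------------------------------------------------------
-- Restrictions and projections

-- Some preimage of y under g, or a junk value if there is none.
module _ (X Y : FinSet) (g : ⟦ X ⟧ → ⟦ Y ⟧) (y : ⟦ Y ⟧) where

  preimage : ⟦ X ⟧
  preimage = choose (Fin.any? λ k → ≟-dec Y (g (element X k)) y)
    where
    choose : Dec (∃ λ k → g (element X k) ≡ y) → ⟦ X ⟧
    choose (yes (k , _)) = element X k
    choose (no  _)       = default X

  preimage-correct : ∀ {x} → g x ≡ y → g preimage ≡ y
  preimage-correct {x} eq with Fin.any? (λ k → ≟-dec Y (g (element X k)) y)
  ... | yes (k , gk≡y) = gk≡y
  ... | no  ¬∃         = ⊥-elim (¬∃ (Inverse.to (FinSet.enum X) x ,
                           trans (cong g (Inverse.strictlyInverseʳ (FinSet.enum X) x)) eq))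

module _ (A : SCA) (Q′ : FinSet) where

  -- F(Y, R^ℤ) ⊆ Y for Y = i(Q′)^ℤ.
  Closed : (⟦ Q′ ⟧ → ⟦ states A ⟧) → Set
  Closed i = ∀ c s → InY c → InY (global A c s)
    where
    InY : Config (states A) → Set
    InY c = ∀ z → ∃ λ q → i q ≡ c z

  -- Meaningful when i is injective and Closed i holds: see restrict-global.
  restrict : (⟦ Q′ ⟧ → ⟦ states A ⟧) → SCA
  restrict i = record
    { states = Q′ ; random = random A
    ; V = V A ; V-unique = V-unique A ; V′ = V′ A ; V′-unique = V′-unique A
    ; f = λ q r → preimage Q′ (states A) i (f A (map i q) r)
    }

  restrict-global : ∀ i → Closed i → ∀ c s z →
                    i (global (restrict i) c s z) ≡ global A (i ∘ c) s z
  restrict-global i closed c s z =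
    trans (cong (λ q → i (preimage Q′ (states A) i (f A q _))) (sym (Vec.map-∘ i _ (V A))))
          (preimage-correct Q′ (states A) i _ (proj₂ (closed (i ∘ c) s (λ x → c x , refl) z)))

  Compatible : (⟦ states A ⟧ → ⟦ Q′ ⟧) → Set
  Compatible π = ∀ s c c′ → (∀ z → π (c z) ≡ π (c′ z)) →
                 ∀ z → π (global A c s z) ≡ π (global A c′ s z)

  -- Meaningful when π is surjective and Compatible π holds: see project-global.
  project : (⟦ states A ⟧ → ⟦ Q′ ⟧) → SCA
  project π = record
    { states = Q′ ; random = random A
    ; V = V A ; V-unique = V-unique A ; V′ = V′ A ; V′-unique = V′-unique A
    ; f = λ q r → π (f A (map (preimage (states A) Q′ π) q) r)
    }

  project-global : ∀ π → Surjective _≡_ _≡_ π → Compatible π → ∀ c c′ s →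
                   (∀ z → π (c z) ≡ c′ z) → ∀ z →
                   global (project π) c′ s z ≡ π (global A c s z)
  project-global π surj compat c c′ s eq z =
    trans (cong (λ q → π (f A q _)) (sym (Vec.map-∘ (preimage (states A) Q′ π) _ (V A))))
          (compat s (preimage (states A) Q′ π ∘ c′) c
            (λ x → trans (preimage-correct (states A) Q′ π _ (proj₂ (surj (c′ x)) refl)) (sym (eq x))) z)

------------------------------------------------------------------------
-- Rescaling

record Scale : Set where
  field
    m t      : ℕ
    {{m≢0}} : NonZero m
    {{t≢0}} : NonZero t
    z        : ℤ

-- -K , … , K
interval : (K : ℕ) → Vec ℤ (suc (K ℕ.+ K))
interval K = tabulate λ k → - + K + + toℕ k

interval-unique : ∀ K → Unique (interval K)
interval-unique K = tabulate⁺ λ eq → Fin.toℕ-injective (ℤ.+-injective (+-cancelˡ (- + K) _ _ eq))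

module _ (A : SCA) (S : Scale) where
  open Scale S

  private
    Q R : FinSet
    Q = states A
    R = random A

  rescaleGlobal : Config (Q ^ᶠ m) → Config ((R ^ᶠ m) ^ᶠ t) → Config (Q ^ᶠ m)
  rescaleGlobal c s =
    block Q m (shift {Q} z
      (iterate A t (unblock Q m c) (λ j → unblock R m (λ x → lookup (s x) j))))

  rescaleRadius : ℕ
  rescaleRadius = ∣ z ∣ ℕ.+ m ℕ.+ t ℕ.* (radius (V A) ℕ.⊔ radius (V′ A)) ℕ.+ m

  -- The automaton with global function rescaleGlobal (see rescale-global).  Both
  -- neighbourhoods are an interval containing every cell on which cell 0 of
  -- rescaleGlobal depends; the local function evaluates rescaleGlobal there.
  rescale : SCA
  rescale = record
    { states = Q ^ᶠ m ; random = (R ^ᶠ m) ^ᶠ t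
    ; V  = interval K ; V-unique  = interval-unique K
    ; V′ = interval K ; V′-unique = interval-unique K
    ; f  = λ q r → rescaleGlobal (fill (Q ^ᶠ m) (- + K) q) (fill ((R ^ᶠ m) ^ᶠ t) (- + K) r) 0ℤ
    }
    where K = rescaleRadius

  rescale-global : ∀ c s x → global rescale c s x ≡ rescaleGlobal c s x
  rescale-global c s x = sym (Vec.tabulate-cong λ k → let v = + toℕ k + z in begin
    iterate A t (unblock Q m c) (parts s) (+ m * x + + toℕ k + z)
      ≡⟨ cong (iterate A t (unblock Q m c) (parts s)) (ℤ.+-assoc (+ m * x) (+ toℕ k) z) ⟩
    iterate A t (unblock Q m c) (parts s) (+ m * x + v)
      ≡⟨ iterate-local A t (∣ z ∣ ℕ.+ m) (unblock Q m c) (unblock Q m c′)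
           (parts s) (parts s′) (+ m * x)
           (unblock-local Q m c c′ _ x (λ y y≤ → sym (filled (Q ^ᶠ m) c y y≤)))
           (λ j → unblock-local R m (λ y → lookup (s y) j) (λ y → lookup (s′ y) j) _ x
             (λ y y≤ → cong (λ w → lookup w j) (sym (filled ((R ^ᶠ m) ^ᶠ t) s y y≤))))
           v (near k) ⟩
    iterate A t (unblock Q m c′) (parts s′) v
      ≡⟨ cong (iterate A t (unblock Q m c′) (parts s′)) (reindex (+ m) (+ toℕ k) z) ⟩
    iterate A t (unblock Q m c′) (parts s′) (+ m * 0ℤ + + toℕ k + z) ∎)
    where
    open ≡-Reasoning
    K = rescaleRadius

    parts : Config ((R ^ᶠ m) ^ᶠ t) → Fin t → Config R
    parts s j = unblock R m (λ x → lookup (s x) j)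

    around : ∀ X → Config X → Config X
    around X d = fill X (- + K) (map (λ v → d (x + v)) (interval K))

    filled : ∀ X d y → ∣ y ∣ ℕ.≤ K → around X d y ≡ d (x + y)
    filled X d y y≤K with offset y y≤K
    ... | j , j≤2K , refl = begin
      around X d (- + K + + j)
        ≡⟨ cong (λ j → around X d (- + K + + j)) (sym (Fin.toℕ-fromℕ< (s≤s j≤2K))) ⟩
      around X d (- + K + + toℕ l)
        ≡⟨ fill-lookup X (- + K) (map (λ v → d (x + v)) (interval K)) l ⟩
      lookup (map (λ v → d (x + v)) (interval K)) l
        ≡⟨ Vec.lookup-map l (λ v → d (x + v)) (interval K) ⟩
      d (x + lookup (interval K) l)
        ≡⟨ cong (λ v → d (x + v)) (Vec.lookup∘tabulate (λ k → - + K + + toℕ k) l) ⟩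
      d (x + (- + K + + toℕ l))
        ≡⟨ cong (λ j → d (x + (- + K + + j))) (Fin.toℕ-fromℕ< (s≤s j≤2K)) ⟩
      d (x + (- + K + + j)) ∎
      where
      l : Fin (suc (K ℕ.+ K))
      l = fromℕ< (s≤s j≤2K)

    c′ = around (Q ^ᶠ m) c
    s′ = around ((R ^ᶠ m) ^ᶠ t) s

    near : ∀ (k : Fin m) → ∣ + toℕ k + z ∣ ℕ.≤ ∣ z ∣ ℕ.+ m
    near k = ℕ.≤-trans (ℤ.∣i+j∣≤∣i∣+∣j∣ (+ toℕ k) z)
      (subst (ℕ._≤ ∣ z ∣ ℕ.+ m) (ℕ.+-comm ∣ z ∣ (toℕ k))
        (ℕ.+-monoʳ-≤ ∣ z ∣ (ℕ.<⇒≤ (Fin.toℕ<n k))))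

    reindex : ∀ m k z → k + z ≡ m * 0ℤ + k + z
    reindex = solve-∀

------------------------------------------------------------------------
-- Simulation

data Kind : Set where
  injection projection mixed : Kind

-- A₁ is related to A₂.
Related : Kind → SCA → SCA → Set₁
Related injection A₁ A₂ =
  Lift (Level.suc 0ℓ) (Σ (⟦ states A₁ ⟧ → ⟦ states A₂ ⟧) λ i →
    Injective _≡_ _≡_ i × Closed A₂ (states A₁) i ×
    (∀ c → _≈ᵐ_ {states A₁} (stochastic A₁ c) (stochastic (restrict A₂ (states A₁) i) c)))
Related projection A₁ A₂ =
  Lift (Level.suc 0ℓ) (Σ (⟦ states A₂ ⟧ → ⟦ states A₁ ⟧) λ π →
    Surjective _≡_ _≡_ π × Compatible A₂ (states A₁) π ×
    (∀ c → _≈ᵐ_ {states A₁} (stochastic A₁ c) (stochastic (project A₂ (states A₁) π) c)))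
Related mixed A₁ A₂ =
  Σ FinSet λ Q′ →
  Σ (⟦ Q′ ⟧ → ⟦ states A₂ ⟧) λ i →
  Σ (⟦ Q′ ⟧ → ⟦ states A₁ ⟧) λ π →
    Injective _≡_ _≡_ i × Closed A₂ Q′ i ×
    Surjective _≡_ _≡_ π × Compatible (restrict A₂ Q′ i) (states A₁) π ×
    (∀ c → _≈ᵐ_ {states A₁} (stochastic A₁ c)
                (stochastic (project (restrict A₂ Q′ i) (states A₁) π) c))

infix 4 _≼[_]_

_≼[_]_ : SCA → Kind → SCA → Set₁
A₁ ≼[ κ ] A₂ = Σ Scale λ S₁ → Σ Scale λ S₂ → Related κ (rescale A₁ S₁) (rescale A₂ S₂)

Universal : Kind → SCA → Set₁
Universal κ A = ∀ B → B ≼[ κ ] A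

{-# OPTIONS --safe #-}
module Submission where

-- Suppose that A, with r random symbols, simulates every automaton.  Rescaling,
-- restriction and projection only replace r by a power of r, so an automaton
-- related to a rescaling of A gives every cylinder a probability of the form
-- k / r^l (stochastic-over, related-over).
--
-- Let B ignore its states and copy noise over r + 1 random symbols.  A rescaling of
-- B gives every cylinder a probability with denominator a power of r + 1.  As r + 1
-- and r are coprime, such a number is also of the form k / r^l only if it is an
-- integer, that is 0 or 1.  Hence each cylinder event holds for all values of the
-- noise or for none (coprime-uniform), and the rescaling of B is insensitive to its
-- noise (coprime-noise-irrelevant).  But noise constantly x yields the
-- configuration constantly x (rescaled-noise), and r + 1 is at least 2.

open import Defs
open import Data.Fin as Fin using (Fin; fromℕ; fromℕ<)
open import Data.Integer using (+_; _+_; _-_; _*_; 0ℤ)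
open import Data.Integer.DivMod using (n%ℕd<d)
import Data.List as List
open import Data.List.Membership.Propositional using (_∈_; lose)
open import Data.List.Membership.Propositional.Properties using (∈-allFin; ∈-map⁺)
import Data.List.Properties as List
open import Data.Nat as ℕ using (ℕ; zero; suc; NonZero; _^_)
open import Data.Nat.Coprimality as Coprime using (Coprime)
open import Data.Nat.Divisibility using (_∣_; divides; ∣-trans; >⇒∤)
import Data.Nat.Properties as ℕ
open import Data.Product using (Σ; ∃₂; _,_)
open import Data.Rational using (_/_)
import Data.Rational.Properties as ℚ
open import Data.Vec as Vec using (Vec; []; _∷_; lookup; replicate)
import Data.Vec.Properties as Vec
import Data.Vec.Relation.Unary.AllPairs as AllPairs
import Data.Vec.Relation.Unary.All as All
open import Function using (Inverse; const)
open import Function.Construct.Identity using (↔-id)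
open import Level using (0ℓ; lift)
open import Relation.Binary.PropositionalEquality
open import Relation.Nullary using (¬_; yes; no; contradiction)
open import Relation.Unary using (Pred; Decidable)

coprime-^ʳ : ∀ {m n} k → Coprime m n → Coprime m (n ^ k)
coprime-^ʳ zero    _   = Coprime.sym (Coprime.1-coprimeTo _)
coprime-^ʳ {m} {n} (suc k) m⊥n {d} (d∣m , d∣n*n^k) =
  coprime-^ʳ k m⊥n (d∣m , Coprime.coprime-divisor d⊥n d∣n*n^k)
  where
  d⊥n : Coprime d n
  d⊥n (e∣d , e∣n) = m⊥n (∣-trans e∣d d∣m , e∣n)

coprime-^ˡ : ∀ {m n} k → Coprime m n → Coprime (m ^ k) n
coprime-^ˡ k m⊥n = Coprime.sym (coprime-^ʳ k (Coprime.sym m⊥n))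

coprime-/⇒∣ : ∀ {m n} .{{_ : NonZero m}} .{{_ : NonZero n}} → Coprime m n →
              ∀ i j → + i / m ≡ + j / n → m ∣ i
coprime-/⇒∣ {m@(suc _)} {n@(suc _)} m⊥n i j eq =
  Coprime.coprime-divisor m⊥n
    (divides j (trans (ℕ.*-comm n i) (ℚ.normalize-injective-≃ i j m n eq)))

∈-elements : ∀ X (x : ⟦ X ⟧) → x ∈ elements X
∈-elements X x = subst (_∈ elements X) (Inverse.strictlyInverseʳ (FinSet.enum X) x)
  (∈-map⁺ (element X) (∈-allFin (Inverse.to (FinSet.enum X) x)))

length-elements : ∀ X → List.length (elements X) ≡ card X
length-elements X = trans (List.length-map (element X) (List.allFin (card X)))
                          (List.length-tabulate {n = card X} (λ k → k))

-- An event of uniform probability j / n with n coprime to the size of the space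
-- has probability 0 or 1, so it cannot separate two points.
coprime-uniform : ∀ X {P : Pred ⟦ X ⟧ 0ℓ} (P? : Decidable P) {n} .{{_ : NonZero n}} →
                  Coprime (card X) n → ∀ j → uniform X P? ≡ + j / n →
                  ∀ x y → P x → P y
coprime-uniform X P? X⊥n j eq x y Px with P? y
... | yes Py = Py
... | no ¬Py = contradiction
  (coprime-/⇒∣ X⊥n (List.length (List.filter P? (elements X))) j eq)
  (>⇒∤ {{ℕ.>-nonZero some}} notAll)
  where
  open FinSet X using (nonZero)
  some   = List.filter-some P? (lose (∈-elements X x) Px)
  notAll = subst (List.length (List.filter P? (elements X)) ℕ.<_) (length-elements X)
    (List.filter-notAll P? (elements X) (lose (∈-elements X y) ¬Py))

-- The event that the noise word w, placed on all the cells that matter, makes A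
-- write the word u at z.
output? : ∀ A c z {n} (u : Vec ⟦ states A ⟧ n) → let N = radius (V′ A) in
          Decidable {A = Vec ⟦ random A ⟧ (n ℕ.+ 2 ℕ.* N)}
            (λ w → window z n (global A c (fill (random A) (z - + N) w)) ≡ u)
output? A c z {n} u w =
  Vec.≡-dec (≟-dec (states A)) (window z n (global A c (fill (random A) (z - + N) w))) u
  where N = radius (V′ A)

-- Every cylinder has a probability of the form k / r^l.
Over : (r : ℕ) .{{_ : NonZero r}} → ∀ {X} → Measure X → Set
Over r {X} μ = ∀ z {n} (u : Vec ⟦ X ⟧ n) →
  ∃₂ λ k l → μ z u ≡ (+ k / r ^ l) {{ℕ.m^n≢0 r l}}

stochastic-over : ∀ A c → let open FinSet (random A) using (nonZero) in
                  Over (card (random A)) {states A} (stochastic A c)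
stochastic-over A c z {n} u =
  List.length (List.filter (output? A c z u) (elements (random A ^ᶠ L))) , L , refl
  where L = n ℕ.+ 2 ℕ.* radius (V′ A)

over-resp-≈ᵐ : ∀ r .{{_ : NonZero r}} {X} {μ ν : Measure X} →
              _≈ᵐ_ {X} μ ν → Over r {X} ν → Over r {X} μ
over-resp-≈ᵐ r μ≈ν over z u with over z u
... | k , l , eq = k , l , trans (μ≈ν z _ u) eq

-- Restrictions and projections of an automaton keep its random symbols.
related-over : ∀ κ A₁ A₂ → Related κ A₁ A₂ → let open FinSet (random A₂) using (nonZero) in
               ∀ c → Over (card (random A₂)) {states A₁} (stochastic A₁ c)
related-over injection A₁ A₂ (lift (i , _ , _ , eq)) c =
  over-resp-≈ᵐ _ {{FinSet.nonZero (random A₂)}} {states A₁} (eq c)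
    (stochastic-over (restrict A₂ (states A₁) i) c)
related-over projection A₁ A₂ (lift (π , _ , _ , eq)) c =
  over-resp-≈ᵐ _ {{FinSet.nonZero (random A₂)}} {states A₁} (eq c)
    (stochastic-over (project A₂ (states A₁) π) c)
related-over mixed A₁ A₂ (Q′ , i , π , _ , _ , _ , _ , eq) c =
  over-resp-≈ᵐ _ {{FinSet.nonZero (random A₂)}} {states A₁} (eq c)
    (stochastic-over (project (restrict A₂ Q′ i) (states A₁) π) c)

-- Any two noises give the same word: by coprime-uniform, the event of writing the
-- word that s produces cannot separate s from s′.
coprime-noise-irrelevant : ∀ A c {r} .{{_ : NonZero r}} → Coprime (card (random A)) r →
  Over r {states A} (stochastic A c) →
  ∀ s s′ z n → window z n (global A c s) ≡ window z n (global A c s′)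
coprime-noise-irrelevant A c {r} A⊥r over s s′ z n =
  let k , l , eq = over z u in
  sym (trans (global-window A c s′ z n)
    (coprime-uniform (random A ^ᶠ L) (output? A c z u) {{ℕ.m^n≢0 r l}}
      (coprime-^ˡ L (coprime-^ʳ l A⊥r)) k eq
      (window a L s) (window a L s′) (sym (global-window A c s z n))))
  where
  L = n ℕ.+ 2 ℕ.* radius (V′ A)
  a = z - + radius (V′ A)
  u = window z n (global A c s)

-- The automaton that replaces each cell by its random symbol.
noise : FinSet → SCA
noise X = record
  { states = X ; random = X
  ; V  = []      ; V-unique  = AllPairs.[]
  ; V′ = 0ℤ ∷ [] ; V′-unique = All.[] AllPairs.∷ AllPairs.[]
  ; f  = λ { _ (x ∷ []) → x }
  }

-- Noise constantly x, over all sub-steps and sub-cells, yields x in all sub-cells: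
-- the result is a shift of the noise of the last sub-step.
rescaled-noise : ∀ X S c x z k → let open Scale S using (m; t) in
  lookup (global (rescale (noise X) S) c (const (replicate t (replicate m x))) z) k ≡ x
rescaled-noise X S@record { m = m ; t = t@(suc t-1) ; z = v } c x z k = begin
  lookup (global (rescale (noise X) S) c s z) k
    ≡⟨ cong (λ w → lookup w k) (rescale-global (noise X) S c s z) ⟩
  lookup (rescaleGlobal (noise X) S c s z) k
    ≡⟨ Vec.lookup∘tabulate _ k ⟩
  lookup (lookup (replicate t (replicate m x)) (fromℕ t-1)) j
    ≡⟨ cong (λ w → lookup w j) (Vec.lookup-replicate (fromℕ t-1) (replicate m x)) ⟩
  lookup (replicate m x) j
    ≡⟨ Vec.lookup-replicate j x ⟩
  x ∎
  where
  open ≡-Reasoning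
  s : Config ((X ^ᶠ m) ^ᶠ t)
  s = const (replicate t (replicate m x))
  -- The cell of the configuration that is read has this position in its block.
  y = (+ m * z + + Fin.toℕ k + v) + 0ℤ
  j = fromℕ< (n%ℕd<d y m)

-- The alphabet of the numbers below n.
finite : (n : ℕ) {{_ : NonZero n}} → FinSet
finite n = record { ⟦_⟧ = Fin n ; card = n ; enum = ↔-id (Fin n) }

corollary8p3 : (κ : Kind) → ¬ (Σ SCA λ A → Universal κ A)
corollary8p3 κ (A , universal) with universal (noise (finite (suc (card (random A)))))
... | S₁ , S₂ , related = contradiction x≡y (λ ())
  where
  module S₁ = Scale S₁
  module S₂ = Scale S₂
  open FinSet (random A) using (nonZero)

  r = card (random A)
  X = finite (suc r)
  B = rescale (noise X) S₁
  R₂ = random (rescale A S₂)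

  B⊥R₂ : Coprime (card (random B)) (card R₂)
  B⊥R₂ = coprime-^ˡ S₁.t (coprime-^ˡ S₁.m (coprime-^ʳ S₂.t (coprime-^ʳ S₂.m
    (subst (λ n → Coprime n r) (ℕ.+-comm r 1) (Coprime.coprime-+ (Coprime.1-coprimeTo r))))))

  c : Config (states B)
  c = const (default (states B))

  -- Two distinct symbols, as A has at least one random symbol.
  x y : Fin (suc r)
  x = Fin.zero
  y = Fin.suc (fromℕ< (ℕ.>-nonZero⁻¹ r))

  -- The first sub-cell of cell 0, which lies within it because m is positive.
  cell : Vec (Vec (Fin (suc r)) S₁.m) 1 → Fin (suc r)
  cell w = lookup (Vec.head w) (fromℕ< (ℕ.>-nonZero⁻¹ S₁.m))

  s : Fin (suc r) → Config (random B)
  s q = const (replicate S₁.t (replicate S₁.m q))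

  x≡y : x ≡ y
  x≡y = begin
    x                                     ≡⟨ rescaled-noise X S₁ c x 0ℤ _ ⟨
    cell (window 0ℤ 1 (global B c (s x))) ≡⟨ cong cell (coprime-noise-irrelevant B c
                                               {{FinSet.nonZero R₂}} B⊥R₂
                                               (related-over κ B (rescale A S₂) related c)
                                               (s x) (s y) 0ℤ 1) ⟩
    cell (window 0ℤ 1 (global B c (s y))) ≡⟨ rescaled-noise X S₁ c y 0ℤ _ ⟩
    y                                     ∎
    where open ≡-Reasoning
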